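{- Let $(\mathbf{A},\Box,\Diamond)$ be a finite G\"odel algebra with operators (GAO). Then $(\mathbf{A},\Box,\Diamond)$ is isomorphic to the GAO $(\mathbf{G}(\mathbf{F}_{\mathbf{A}}),\beta,\delta)$ through the mapping $r:A\to G(\mathbf{F}_{\mathbf{A}})$ given, for every $a\in A$, by $r(a)=\{f\in F_{\mathbf{A}}\mid a\in f\}$. In particular, for all $a\in A$, $$r(\Box(a))=\beta(r(a))\quad\text{and}\quad r(\Diamond(a))=\delta(r(a)).$$
   Context: A G\"odel algebra is a Heyting algebra $\mathbf{A}=(A,\wedge,\vee,\to,\bot,\top)$ satisfying prelinearity $(a\to b)\vee(b\to a)=\top$. A G\"odel algebra with operators (GAO) is a triple $(\mathbf{A},\Box,\Diamond)$ with $\mathbf{A}$ a G\"odel algebra and $\Box,\Diamond:A\to A$ satisfying $\Box\top=\top$, $\Box(x\wedge y)=\Box x\wedge\Box y$, $\Diamond\bot=\bot$, $\Diamond(x\vee y)=\Diamond x\vee\Diamond y$. A forest is a finite poset in which the downset of each element is totally ordered. For a finite G\"odel algebra $\mathbf{A}$, $F_{\mathbf{A}}$ is the set of its prime (proper) filters, ordered by $f_1\leq f_2$ iff $f_1\supseteq f_2$; $\mathbf{F}_{\mathbf{A}}=(F_{\mathbf{A}},\leq)$ is a finite forest. For a finite forest $\mathbf{F}=(F,\leq)$, $G(\mathbf{F})$ is the set of all downward closed subsets of $F$, and $\mathbf{G}(\mathbf{F})=(G(\mathbf{F}),\cap,\cup,\to,\emptyset,F)$ with $x\to y=F\setminus{\uparrow}(x\setminus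 y)$, which is a G\"odel algebra. For a GAO $(\mathbf{A},\Box,\Diamond)$, define relations on $F_{\mathbf{A}}$: $f_1R_\Box f_2$ iff $\Box^{ -1}(f_1)\subseteq f_2$; $f_1R_\Diamond f_2$ iff $f_2\subseteq\Diamond^{ -1}(f_1)$ (equivalently $\Diamond(f_2)\subseteq f_1$). Then for $a\in G(\mathbf{F}_{\mathbf{A}})$: $\beta(a)=\{y\in F_{\mathbf{A}}\mid\forall z\in F_{\mathbf{A}},\ (yR_\Box z\Rightarrow z\in a)\}$ and $\delta(a)=\{y\in F_{\mathbf{A}}\mid\exists z\in a,\ yR_\Diamond z\}$. -}

module Defs where

open import Algebra.Core using (Op₁; Op₂)
open import Algebra.Morphism.Definitions
  using (Homomorphic₀; Homomorphic₁; Homomorphic₂)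
open import Data.Bool.Base using (Bool; true; false; T)
open import Data.Bool.Properties using (T?)
open import Data.Empty using (⊥-elim)
open import Data.Fin.Base using (Fin; zero; suc)
import Data.Fin.Properties as Fin
open import Data.List.Base as List using (List; []; _∷_; _++_; deduplicate)
import Data.List.Membership.Propositional as Propositional
open import Data.List.Membership.Propositional.Properties
  using (∈-++⁺ˡ; ∈-++⁺ʳ; ∈-map⁺; ∈-lookup)
import Data.List.Membership.Setoid as Membership
open import Data.List.Membership.Setoid.Properties using (∈-deduplicate⁺)
import Data.List.Relation.Unary.All as All
open import Data.List.Relation.Unary.AllPairs using (_∷_)
open import Data.List.Relation.Unary.Any as Any using (here; there)
import Data.List.Relation.Unary.Any.Properties as Any
open import Data.List.Relation.Unary.Enumerates.Setoid using (IsEnumeration)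
import Data.List.Relation.Unary.Unique.Setoid as Unique
open import Data.List.Relation.Unary.Unique.DecSetoid.Properties
  using (deduplicate-!)
open import Data.Maybe.Base using (Maybe; just; nothing)
import Data.Maybe.Relation.Unary.Any as Maybe
open import Data.Nat.Base using (ℕ)
open import Data.Product.Base using (∃; _×_; _,_; proj₁; proj₂)
open import Data.Sum.Base using (_⊎_; inj₁; inj₂)
import Data.Sum.Base as Sum
open import Data.Unit.Base using (tt)
open import Data.Vec.Base using (Vec; []; _∷_; lookup; tabulate)
open import Data.Vec.Properties using (lookup∘tabulate)
open import Function.Base using (_∘_; id)
open import Function.Bundles using (Inverse)
open import Function.Definitions using (Bijective; Congruent)
open import Level using (Level; _⊔_; 0ℓ) renaming (suc to lsuc)
open import Relation.Binary.Bundles using (Setoid; DecSetoid; DecPoset)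
open import Relation.Binary.Core using (Rel)
import Relation.Binary.Definitions as Binary
open import Relation.Binary.Lattice using (HeytingAlgebra)
import Relation.Binary.Lattice.Properties.JoinSemilattice as JoinProperties
import Relation.Binary.Lattice.Properties.MeetSemilattice as MeetProperties
open import Relation.Binary.PropositionalEquality as ≡ using (_≡_)
open import Relation.Nullary using (¬_; Dec; yes; no; contradiction)
open import Relation.Nullary.Decidable
  using (isYes; toWitness; fromWitness; map′; ¬?; _×-dec_; _⊎-dec_; _→-dec_;
         decidable-stable)
open import Relation.Unary
  using (Pred; Decidable; _∈_; _∉_; _⊆_; _≐_; _⊢_)

private
  variable
    a c c′ ℓ ℓ₁ ℓ₂ ℓ₁′ ℓ₂′ p : Level

record Finite (S : Setoid c ℓ) : Set (c ⊔ ℓ) where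
  open Setoid S
  field
    size      : ℕ
    bijection : Inverse S (≡.setoid (Fin size))

  open Inverse bijection public
    using (to; from; to-cong; strictlyInverseʳ)

  abstract
    _≟_ : Binary.Decidable _≈_
    x ≟ y = map′
      (λ eq → trans (sym (strictlyInverseʳ x))
                (trans (reflexive (≡.cong from eq)) (strictlyInverseʳ y)))
      to-cong
      (to x Fin.≟ to y)

    all? : {P : Pred Carrier p} → P Binary.Respects _≈_ → Decidable P →
           Dec (∀ x → P x)
    all? resp P? = map′
      (λ h x → resp (strictlyInverseʳ x) (h (to x)))
      (λ h i → h (from i))
      (Fin.all? (P? ∘ from))

    any? : {P : Pred Carrier p} → P Binary.Respects _≈_ → Decidable P →
           Dec (∃ P)
    any? resp P? = map′
      (λ (i , Pi) → from i , Pi)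
      (λ (x , Px) → to x , resp (sym (strictlyInverseʳ x)) Px)
      (Fin.any? (P? ∘ from))

-- An enumeration, possibly with repetitions, of a setoid with decidable
-- equality gives a bijection with some Fin n.
module _ (S : DecSetoid c ℓ) where
  open DecSetoid S
  open Membership setoid using () renaming (_∈_ to _∈ₗ_)
  open Unique setoid using (Unique)

  private
    lookup-injective : ∀ {xs} → Unique xs → ∀ i j →
                       List.lookup xs i ≈ List.lookup xs j → i ≡ j
    lookup-injective (_ ∷ _)    zero    zero    _  = ≡.refl
    lookup-injective (x≉ ∷ _)   zero    (suc j) eq =
      contradiction eq (All.lookup x≉ (∈-lookup j))
    lookup-injective (x≉ ∷ _)   (suc i) zero    eq =
      contradiction (sym eq) (All.lookup x≉ (∈-lookup i))
    lookup-injective (_ ∷ uniq) (suc i) (suc j) eq =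
      ≡.cong suc (lookup-injective uniq i j eq)

  enumeration⇒finite : ∀ {xs} → IsEnumeration setoid xs → Finite setoid
  enumeration⇒finite {xs} enum = record
    { size      = List.length ys
    ; bijection = record
      { to        = index
      ; from      = List.lookup ys
      ; to-cong   = λ {x} {y} x≈y → injective
          (trans (sym (lookup-index x)) (trans x≈y (lookup-index y)))
      ; from-cong = λ { ≡.refl → refl }
      ; inverse   = (λ {_} {x} x≈ → injective (trans (sym (lookup-index x)) x≈))
                  , (λ { {x} ≡.refl → sym (lookup-index x) })
      }
    }
    where
    ys : List Carrier
    ys = deduplicate _≟_ xs

    y∈ys : ∀ y → y ∈ₗ ys
    y∈ys y = ∈-deduplicate⁺ setoid _≟_ (λ z≈y x≈y → trans x≈y (sym z≈y)) (enum y)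

    index : Carrier → Fin (List.length ys)
    index y = Any.index (y∈ys y)

    lookup-index : ∀ y → y ≈ List.lookup ys (index y)
    lookup-index y = Any.lookup-index (y∈ys y)

    injective : ∀ {i j} → List.lookup ys i ≈ List.lookup ys j → i ≡ j
    injective = lookup-injective (deduplicate-! S xs) _ _

record GodelAlgebra c ℓ₁ ℓ₂ : Set (lsuc (c ⊔ ℓ₁ ⊔ ℓ₂)) where
  field
    heytingAlgebra : HeytingAlgebra c ℓ₁ ℓ₂

  open HeytingAlgebra heytingAlgebra public

  field
    prelinear : ∀ x y → (x ⇨ y) ∨ (y ⇨ x) ≈ ⊤

record GAO c ℓ₁ ℓ₂ : Set (lsuc (c ⊔ ℓ₁ ⊔ ℓ₂)) where
  field
    godelAlgebra : GodelAlgebra c ℓ₁ ℓ₂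

  open GodelAlgebra godelAlgebra public

  field
    □ ◇    : Op₁ Carrier
    □-cong : Congruent _≈_ _≈_ □
    ◇-cong : Congruent _≈_ _≈_ ◇
    □-⊤    : □ ⊤ ≈ ⊤
    □-∧    : ∀ x y → □ (x ∧ y) ≈ □ x ∧ □ y
    ◇-⊥    : ◇ ⊥ ≈ ⊥
    ◇-∨    : ∀ x y → ◇ (x ∨ y) ≈ ◇ x ∨ ◇ y

record IsGAOIsomorphism
  (A : GAO c ℓ₁ ℓ₂) (B : GAO c′ ℓ₁′ ℓ₂′) (f : GAO.Carrier A → GAO.Carrier B) :
  Set (c ⊔ ℓ₁ ⊔ c′ ⊔ ℓ₁′) where
  private
    module A = GAO A
    module B = GAO B
  field
    cong      : Congruent A._≈_ B._≈_ f
    ∧-homo    : Homomorphic₂ A.Carrier B.Carrier B._≈_ f A._∧_ B._∧_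
    ∨-homo    : Homomorphic₂ A.Carrier B.Carrier B._≈_ f A._∨_ B._∨_
    ⇨-homo    : Homomorphic₂ A.Carrier B.Carrier B._≈_ f A._⇨_ B._⇨_
    ⊥-homo    : Homomorphic₀ A.Carrier B.Carrier B._≈_ f A.⊥ B.⊥
    ⊤-homo    : Homomorphic₀ A.Carrier B.Carrier B._≈_ f A.⊤ B.⊤
    □-homo    : Homomorphic₁ A.Carrier B.Carrier B._≈_ f A.□ B.□
    ◇-homo    : Homomorphic₁ A.Carrier B.Carrier B._≈_ f A.◇ B.◇
    bijective : Bijective A._≈_ B._≈_ f

-- Subsets of a finite set are given by their characteristic functions:
-- classically these are all the subsets, and constructively they are the
-- decidable ones.

⟦_⟧ᵇ : {A : Set a} → (A → Bool) → Pred A 0ℓ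
⟦ χ ⟧ᵇ x = T (χ x)

isYes-≐ : {A : Set a} {P : Pred A p} (P? : Decidable P) → ⟦ isYes ∘ P? ⟧ᵇ ≐ P
isYes-≐ P? = (λ {x} → toWitness {a? = P? x}) , (λ {x} → fromWitness {a? = P? x})

record Forest c ℓ₁ ℓ₂ : Set (lsuc (c ⊔ ℓ₁ ⊔ ℓ₂)) where
  field
    decPoset : DecPoset c ℓ₁ ℓ₂

  open DecPoset decPoset public

  field
    finite        : Finite Eq.setoid
    downset-total : ∀ {x y z} → x ≤ z → y ≤ z → x ≤ y ⊎ y ≤ x

module _ (F : Forest c ℓ₁ ℓ₂) where
  open Forest F

  record Downset : Set (c ⊔ ℓ₂) where
    field
      member : Carrier → Bool
      closed : ∀ {x y} → y ≤ x → x ∈ ⟦ member ⟧ᵇ → y ∈ ⟦ member ⟧ᵇ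

module _ {F : Forest c ℓ₁ ℓ₂} where
  open Forest F

  ⟦_⟧ : Downset F → Pred Carrier 0ℓ
  ⟦ U ⟧ = ⟦ Downset.member U ⟧ᵇ

  infix 4 _∈?_
  _∈?_ : ∀ x U → Dec (x ∈ ⟦ U ⟧)
  x ∈? U = T? (Downset.member U x)

  ⟦⟧-resp : ∀ U → ⟦ U ⟧ Binary.Respects _≈_
  ⟦⟧-resp U x≈y = Downset.closed U (reflexive (Eq.sym x≈y))

  module _ {P : Pred Carrier p} where

    comprehension : Decidable P → (∀ {x y} → y ≤ x → P x → P y) → Downset F
    comprehension P? P-closed = record
      { member = isYes ∘ P?
      ; closed = λ y≤x x∈ → proj₂ (isYes-≐ P?) (P-closed y≤x (proj₁ (isYes-≐ P?) x∈))
      }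

module _ (F : Forest c ℓ₁ ℓ₂) where
  open Forest F
  open Finite finite using (any?)

  -- Up∖ U V is ↑(U ∖ V).
  Up∖ : Downset F → Downset F → Pred Carrier (c ⊔ ℓ₂)
  Up∖ U V y = ∃ λ z → z ≤ y × z ∈ ⟦ U ⟧ × z ∉ ⟦ V ⟧

  private
    up∖? : ∀ U V → Decidable (Up∖ U V)
    up∖? U V y = any?
      (λ { z≈w (z≤y , z∈U , z∉V) →
             trans (reflexive (Eq.sym z≈w)) z≤y
           , ⟦⟧-resp U z≈w z∈U
           , z∉V ∘ ⟦⟧-resp V (Eq.sym z≈w) })
      (λ z → (z ≤? y) ×-dec (z ∈? U) ×-dec ¬? (z ∈? V))

  _∪ᴰ_ _∩ᴰ_ _⇨ᴰ_ : Op₂ (Downset F)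
  U ∪ᴰ V = comprehension {P = λ y → y ∈ ⟦ U ⟧ ⊎ y ∈ ⟦ V ⟧}
    (λ y → (y ∈? U) ⊎-dec (y ∈? V))
    (λ y≤x → Sum.map (Downset.closed U y≤x) (Downset.closed V y≤x))
  U ∩ᴰ V = comprehension {P = λ y → y ∈ ⟦ U ⟧ × y ∈ ⟦ V ⟧}
    (λ y → (y ∈? U) ×-dec (y ∈? V))
    (λ { y≤x (x∈U , x∈V) → Downset.closed U y≤x x∈U , Downset.closed V y≤x x∈V })
  U ⇨ᴰ V = comprehension {P = λ y → ¬ Up∖ U V y}
    (λ y → ¬? (up∖? U V y))
    (λ { y≤x x∉ (z , z≤y , z∈) → x∉ (z , trans z≤y y≤x , z∈) })

  ∅ᴰ Fᴰ : Downset F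
  ∅ᴰ = record { member = λ _ → false ; closed = λ _ () }
  Fᴰ = record { member = λ _ → true  ; closed = λ _ _ → tt }

  ∪-≐ : ∀ U V → ⟦ U ∪ᴰ V ⟧ ≐ λ y → y ∈ ⟦ U ⟧ ⊎ y ∈ ⟦ V ⟧
  ∪-≐ U V = isYes-≐ (λ y → (y ∈? U) ⊎-dec (y ∈? V))

  ∩-≐ : ∀ U V → ⟦ U ∩ᴰ V ⟧ ≐ λ y → y ∈ ⟦ U ⟧ × y ∈ ⟦ V ⟧
  ∩-≐ U V = isYes-≐ (λ y → (y ∈? U) ×-dec (y ∈? V))

  ⇨-≐ : ∀ U V → ⟦ U ⇨ᴰ V ⟧ ≐ λ y → ¬ Up∖ U V y
  ⇨-≐ U V = isYes-≐ (λ y → ¬? (up∖? U V y))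

  private
    transpose : ∀ U V W → ⟦ U ∩ᴰ V ⟧ ⊆ ⟦ W ⟧ → ⟦ U ⟧ ⊆ ⟦ V ⇨ᴰ W ⟧
    transpose U V W h y∈U = proj₂ (⇨-≐ V W) λ { (z , z≤y , z∈V , z∉W) →
      z∉W (h (proj₂ (∩-≐ U V) (Downset.closed U z≤y y∈U , z∈V))) }

    untranspose : ∀ U V W → ⟦ U ⟧ ⊆ ⟦ V ⇨ᴰ W ⟧ → ⟦ U ∩ᴰ V ⟧ ⊆ ⟦ W ⟧
    untranspose U V W h {y} y∈ =
      let y∈U , y∈V = proj₁ (∩-≐ U V) y∈ in
      decidable-stable (y ∈? W) λ y∉W →
        proj₁ (⇨-≐ V W) (h y∈U) (y , refl , y∈V , y∉W)

    prelinear : ∀ U V → ⟦ (U ⇨ᴰ V) ∪ᴰ (V ⇨ᴰ U) ⟧ ≐ ⟦ Fᴰ ⟧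
    prelinear U V = (λ _ → tt) , λ {y} _ → proj₂ (∪-≐ (U ⇨ᴰ V) (V ⇨ᴰ U))
      (compare (up∖? U V y) (up∖? V U y))
      where
      compare : ∀ {y} → Dec (Up∖ U V y) → Dec (Up∖ V U y) →
                y ∈ ⟦ U ⇨ᴰ V ⟧ ⊎ y ∈ ⟦ V ⇨ᴰ U ⟧
      compare (no y∉) _       = inj₁ (proj₂ (⇨-≐ U V) y∉)
      compare _       (no y∉) = inj₂ (proj₂ (⇨-≐ V U) y∉)
      compare (yes (z , z≤y , z∈U , z∉V)) (yes (w , w≤y , w∈V , w∉U)) =
        Sum.[ (λ z≤w → contradiction (Downset.closed V z≤w w∈V) z∉V)
            , (λ w≤z → contradiction (Downset.closed U w≤z z∈U) w∉U)
            ]′ (downset-total z≤y w≤y)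

  𝐆 : GodelAlgebra (c ⊔ ℓ₂) c c
  𝐆 = record
    { heytingAlgebra = record
      { Carrier = Downset F
      ; _≈_     = λ U V → ⟦ U ⟧ ≐ ⟦ V ⟧
      ; _≤_     = λ U V → ⟦ U ⟧ ⊆ ⟦ V ⟧
      ; _∨_     = _∪ᴰ_
      ; _∧_     = _∩ᴰ_
      ; _⇨_     = _⇨ᴰ_
      ; ⊤       = Fᴰ
      ; ⊥       = ∅ᴰ
      ; isHeytingAlgebra = record
        { isBoundedLattice = record
          { isLattice = record
            { isPartialOrder = record
              { isPreorder = record
                { isEquivalence = record
                  { refl  = id , id
                  ; sym   = λ (U⊆V , V⊆U) → V⊆U , U⊆V
                  ; trans = λ (U⊆V , V⊆U) (V⊆W , W⊆V) →
                      (λ x∈ → V⊆W (U⊆V x∈)) , (λ x∈ → V⊆U (W⊆V x∈))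
                  }
                ; reflexive = proj₁
                ; trans     = λ U⊆V V⊆W x∈ → V⊆W (U⊆V x∈)
                }
              ; antisym = _,_
              }
            ; supremum = λ U V →
                (λ x∈ → proj₂ (∪-≐ U V) (inj₁ x∈))
              , (λ x∈ → proj₂ (∪-≐ U V) (inj₂ x∈))
              , λ W U⊆W V⊆W x∈ → Sum.[ U⊆W , V⊆W ]′ (proj₁ (∪-≐ U V) x∈)
            ; infimum = λ U V →
                (λ x∈ → proj₁ (proj₁ (∩-≐ U V) x∈))
              , (λ x∈ → proj₂ (proj₁ (∩-≐ U V) x∈))
              , λ W W⊆U W⊆V x∈ → proj₂ (∩-≐ U V) (W⊆U x∈ , W⊆V x∈)
            }
          ; maximum = λ _ _ → tt
          ; minimum = λ _ ()
          }
        ; exponential = λ U V W → transpose U V W , untranspose U V W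
        }
      }
    ; prelinear = prelinear
    }

module _ (A : GodelAlgebra c ℓ₁ ℓ₂) where
  open GodelAlgebra A

  record IsPrimeFilter (f : Pred Carrier ℓ) : Set (c ⊔ ℓ₂ ⊔ ℓ) where
    field
      ⊤∈       : ⊤ ∈ f
      ∧-closed : ∀ {x y} → x ∈ f → y ∈ f → x ∧ y ∈ f
      upward   : ∀ {x y} → x ≤ y → x ∈ f → y ∈ f
      proper   : ⊥ ∉ f
      prime    : ∀ {x y} → x ∨ y ∈ f → x ∈ f ⊎ y ∈ f

  record PrimeFilter : Set (c ⊔ ℓ₂) where
    field
      member        : Carrier → Bool
      isPrimeFilter : IsPrimeFilter ⟦ member ⟧ᵇ

    open IsPrimeFilter isPrimeFilter public

module _ {A : GodelAlgebra c ℓ₁ ℓ₂} where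

  El : PrimeFilter A → Pred (GodelAlgebra.Carrier A) 0ℓ
  El f = ⟦ PrimeFilter.member f ⟧ᵇ

  El? : ∀ f → Decidable (El f)
  El? f x = T? (PrimeFilter.member f x)

module _ (A : GodelAlgebra c ℓ₁ ℓ₂) (A-finite : Finite (GodelAlgebra.setoid A)) where
  open GodelAlgebra A
  open Finite A-finite using (size; to; from; to-cong; strictlyInverseʳ; all?; _≟_)
  open MeetProperties meetSemilattice using (∧-cong)
  open JoinProperties joinSemilattice using (∨-cong)

  private
    El-resp : ∀ f → El {A = A} f Binary.Respects _≈_
    El-resp f x≈y = PrimeFilter.upward f (reflexive x≈y)

    _⊇?_ : ∀ (f g : PrimeFilter A) → Dec (El g ⊆ El f)
    f ⊇? g = map′ (λ h {x} → h x) (λ h x → h {x}) (all?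
      (λ x≈y h y∈g → El-resp f x≈y (h (El-resp g (Eq.sym x≈y) y∈g)))
      (λ x → El? g x →-dec El? f x))

    ⊇-total : ∀ {f g h : PrimeFilter A} → El h ⊆ El f → El h ⊆ El g →
              El g ⊆ El f ⊎ El f ⊆ El g
    ⊇-total {f} {g} {h} h⊆f h⊆g with f ⊇? g | g ⊇? f
    ... | yes g⊆f | _       = inj₁ g⊆f
    ... | _       | yes f⊆g = inj₂ f⊆g
    ... | no g⊈f  | no f⊈g  = ⊥-elim (g⊈f λ {x} x∈g →
      decidable-stable (El? f x) λ x∉f → f⊈g λ {y} y∈f →
      decidable-stable (El? g y) λ y∉g →
      Sum.[ (λ x⇨y∈h → y∉g (PrimeFilter.upward g (mp x y)
                         (PrimeFilter.∧-closed g (h⊆g x⇨y∈h) x∈g)))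
          , (λ y⇨x∈h → x∉f (PrimeFilter.upward f (mp y x)
                         (PrimeFilter.∧-closed f (h⊆f y⇨x∈h) y∈f))) ]′
      (PrimeFilter.prime h
        (PrimeFilter.upward h (reflexive (Eq.sym (prelinear x y))) (PrimeFilter.⊤∈ h))))
      where
      mp : ∀ x y → (x ⇨ y) ∧ x ≤ y
      mp x y = transpose-∧ refl

    _≤?_ : Binary.Decidable _≤_
    x ≤? y = map′
      (λ x∧y≈x → trans (reflexive (Eq.sym x∧y≈x)) (x∧y≤y x y))
      (λ x≤y → antisym (x∧y≤x x y) (∧-greatest refl x≤y))
      ((x ∧ y) ≟ x)

  primeFilterPoset : DecPoset (c ⊔ ℓ₂) c c
  primeFilterPoset = record
    { Carrier = PrimeFilter A
    ; _≈_     = λ f g → El f ≐ El g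
    ; _≤_     = λ f g → El g ⊆ El f
    ; isDecPartialOrder = record
      { isPartialOrder = record
        { isPreorder = record
          { isEquivalence = record
            { refl  = id , id
            ; sym   = λ (f⊆g , g⊆f) → g⊆f , f⊆g
            ; trans = λ (f⊆g , g⊆f) (g⊆h , h⊆g) →
                (λ x∈ → g⊆h (f⊆g x∈)) , (λ x∈ → g⊆f (h⊆g x∈))
            }
          ; reflexive = proj₂
          ; trans     = λ g⊆f h⊆g x∈ → g⊆f (h⊆g x∈)
          }
        ; antisym = λ g⊆f f⊆g → f⊆g , g⊆f
        }
      ; _≟_  = λ f g → (g ⊇? f) ×-dec (f ⊇? g)
      ; _≤?_ = _⊇?_
      }
    }

  private
    allVectors : ∀ n → List (Vec Bool n)
    allVectors ℕ.zero    = [] ∷ []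
    allVectors (ℕ.suc n) = List.map (true ∷_) (allVectors n)
                             ++ List.map (false ∷_) (allVectors n)

    ∈-allVectors : ∀ {n} (v : Vec Bool n) → v Propositional.∈ allVectors n
    ∈-allVectors []          = here ≡.refl
    ∈-allVectors (true  ∷ v) = ∈-++⁺ˡ (∈-map⁺ (true ∷_) (∈-allVectors v))
    ∈-allVectors (false ∷ v) = ∈-++⁺ʳ _ (∈-map⁺ (false ∷_) (∈-allVectors v))

    all₂? : {P : Carrier → Carrier → Set p} →
            (∀ {x x′ y y′} → x ≈ x′ → y ≈ y′ → P x y → P x′ y′) →
            Binary.Decidable P → Dec (∀ x y → P x y)
    all₂? resp P? = all? (λ x≈x′ h y → resp x≈x′ Eq.refl (h y))
      (λ x → all? (resp Eq.refl) (P? x))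

    isPrimeFilter? : ∀ {f : Pred Carrier p} → f Binary.Respects _≈_ →
                     Decidable f → Dec (IsPrimeFilter A f)
    isPrimeFilter? {f = f} resp f? = map′
      (λ (t , m , u , b , p) → record
        { ⊤∈ = t ; ∧-closed = m _ _ ; upward = u _ _ ; proper = b ; prime = p _ _ })
      (λ F → let open IsPrimeFilter F in
        ⊤∈ , (λ _ _ → ∧-closed) , (λ _ _ → upward) , proper , (λ _ _ → prime))
      (      f? ⊤
      ×-dec  all₂? (λ x≈ y≈ h x∈ y∈ → resp (∧-cong x≈ y≈)
                     (h (resp (Eq.sym x≈) x∈) (resp (Eq.sym y≈) y∈)))
                   (λ x y → f? x →-dec f? y →-dec f? (x ∧ y))
      ×-dec  all₂? (λ x≈ y≈ h x≤y x∈ → resp y≈ (h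
                     (trans (reflexive x≈) (trans x≤y (reflexive (Eq.sym y≈))))
                     (resp (Eq.sym x≈) x∈)))
                   (λ x y → (x ≤? y) →-dec f? x →-dec f? y)
      ×-dec  ¬? (f? ⊥)
      ×-dec  all₂? (λ x≈ y≈ h x∨y∈ → Sum.map (resp x≈) (resp y≈)
                     (h (resp (∨-cong (Eq.sym x≈) (Eq.sym y≈)) x∨y∈)))
                   (λ x y → f? (x ∨ y) →-dec (f? x ⊎-dec f? y)))

    ⟪_⟫ : Vec Bool size → Carrier → Bool
    ⟪ v ⟫ x = lookup v (to x)

    fromVector? : ∀ v → Dec (IsPrimeFilter A ⟦ ⟪ v ⟫ ⟧ᵇ)
    fromVector? v = isPrimeFilter?
      (λ x≈y → ≡.subst (T ∘ lookup v) (to-cong x≈y)) (λ x → T? (⟪ v ⟫ x))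

    fromVector : Vec Bool size → Maybe (PrimeFilter A)
    fromVector v with fromVector? v
    ... | yes F = just (record { member = ⟪ v ⟫ ; isPrimeFilter = F })
    ... | no  _ = nothing

    toVector : PrimeFilter A → Vec Bool size
    toVector f = tabulate (PrimeFilter.member f ∘ from)

    toVector-≐ : ∀ f → El f ≐ ⟦ ⟪ toVector f ⟫ ⟧ᵇ
    toVector-≐ f =
        (λ {x} x∈ → ≡.subst T (≡.sym (eq x)) (El-resp f (Eq.sym (strictlyInverseʳ x)) x∈))
      , (λ {x} x∈ → El-resp f (strictlyInverseʳ x) (≡.subst T (eq x) x∈))
      where
      eq : ∀ x → ⟪ toVector f ⟫ x ≡ PrimeFilter.member f (from (to x))
      eq x = lookup∘tabulate (PrimeFilter.member f ∘ from) (to x)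

    fromVector-toVector : ∀ f → Maybe.Any (λ g → El f ≐ El g) (fromVector (toVector f))
    fromVector-toVector f with fromVector? (toVector f)
    ... | yes _ = Maybe.just (toVector-≐ f)
    ... | no ¬F = contradiction isPF ¬F
      where
      open PrimeFilter f
      ⊆v = λ {x} → proj₁ (toVector-≐ f) {x}
      v⊆ = λ {x} → proj₂ (toVector-≐ f) {x}
      isPF : IsPrimeFilter A ⟦ ⟪ toVector f ⟫ ⟧ᵇ
      isPF = record
        { ⊤∈       = ⊆v ⊤∈
        ; ∧-closed = λ x∈ y∈ → ⊆v (∧-closed (v⊆ x∈) (v⊆ y∈))
        ; upward   = λ x≤y x∈ → ⊆v (upward x≤y (v⊆ x∈))
        ; proper   = λ ⊥∈ → proper (v⊆ ⊥∈)
        ; prime    = λ x∨y∈ → Sum.map ⊆v ⊆v (prime (v⊆ x∨y∈))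
        }

  abstract
    primeFilters-finite : Finite (DecPoset.Eq.setoid primeFilterPoset)
    primeFilters-finite = enumeration⇒finite (DecPoset.Eq.decSetoid primeFilterPoset)
      λ f → Any.mapMaybe⁺ fromVector (allVectors size)
        (Any.map⁺ (Any.map (λ { ≡.refl → fromVector-toVector f })
          (∈-allVectors (toVector f))))

  𝐅 : Forest (c ⊔ ℓ₂) c c
  𝐅 = record
    { decPoset      = primeFilterPoset
    ; finite        = primeFilters-finite
    ; downset-total = λ {f} {g} {h} → ⊇-total {f} {g} {h}
    }

  r : Carrier → Downset 𝐅
  r x = comprehension {P = λ f → x ∈ El f} (λ f → El? f x) (λ f⊆g → f⊆g)

module _ (A : GAO c ℓ₁ ℓ₂) (A-finite : Finite (GAO.setoid A)) where
  open GAO A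

  private
    F : Forest (c ⊔ ℓ₂) c c
    F = 𝐅 godelAlgebra A-finite

    module A where
      open Finite A-finite public using (all?)

    module F where
      open Forest F public
      open Finite finite public using (all?; any?)

    module G = GodelAlgebra (𝐆 F)

    El-resp : ∀ (f : F.Carrier) → El f Binary.Respects _≈_
    El-resp f x≈y = PrimeFilter.upward f (reflexive x≈y)

  R□ R◇ : Rel (PrimeFilter godelAlgebra) c
  R□ f₁ f₂ = (□ ⊢ El f₁) ⊆ El f₂
  R◇ f₁ f₂ = El f₂ ⊆ (◇ ⊢ El f₁)

  private
    R□? : Binary.Decidable R□
    R□? f₁ f₂ = map′ (λ h {x} → h x) (λ h x → h {x}) (A.all?
      (λ x≈y h □y∈ → El-resp f₂ x≈y (h (El-resp f₁ (□-cong (Eq.sym x≈y)) □y∈)))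
      (λ x → El? f₁ (□ x) →-dec El? f₂ x))

    R◇? : Binary.Decidable R◇
    R◇? f₁ f₂ = map′ (λ h {x} → h x) (λ h x → h {x}) (A.all?
      (λ x≈y h y∈ → El-resp f₁ (◇-cong x≈y) (h (El-resp f₂ (Eq.sym x≈y) y∈)))
      (λ x → El? f₂ x →-dec El? f₁ (◇ x)))

  Box Dia : Downset F → Pred F.Carrier (c ⊔ ℓ₂)
  Box U y = ∀ z → R□ y z → z ∈ ⟦ U ⟧
  Dia U y = ∃ λ z → z ∈ ⟦ U ⟧ × R◇ y z

  private
    box? : ∀ U → Decidable (Box U)
    box? U y = F.all?
      (λ {z} {w} z≈w h yRw → ⟦⟧-resp U {z} {w} z≈w (h (λ x∈ → proj₂ z≈w (yRw x∈))))
      (λ z → R□? y z →-dec (z ∈? U))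

    dia? : ∀ U → Decidable (Dia U)
    dia? U y = F.any?
      (λ { {z} {w} z≈w (z∈U , yRz) →
             ⟦⟧-resp U {z} {w} z≈w z∈U , (λ x∈ → yRz (proj₂ z≈w x∈)) })
      (λ z → (z ∈? U) ×-dec R◇? y z)

  β δ : Downset F → Downset F
  β U = comprehension {P = Box U} (box? U)
    (λ x⊆y h z yRz → h z (λ □a∈x → yRz (x⊆y □a∈x)))
  δ U = comprehension {P = Dia U} (dia? U)
    (λ { x⊆y (z , z∈U , xRz) → z , z∈U , (λ a∈z → x⊆y (xRz a∈z)) })

  β-≐ : ∀ U → ⟦ β U ⟧ ≐ Box U
  β-≐ U = isYes-≐ (box? U)

  δ-≐ : ∀ U → ⟦ δ U ⟧ ≐ Dia U
  δ-≐ U = isYes-≐ (dia? U)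

  private
    β-mono : ∀ {U V} → U G.≤ V → β U G.≤ β V
    β-mono {U} {V} U⊆V {y} y∈ = proj₂ (β-≐ V) {y}
      (λ z yRz → U⊆V {z} (proj₁ (β-≐ U) {y} y∈ z yRz))

    δ-mono : ∀ {U V} → U G.≤ V → δ U G.≤ δ V
    δ-mono {U} {V} U⊆V {y} y∈ = proj₂ (δ-≐ V) {y}
      (let z , z∈U , yRz = proj₁ (δ-≐ U) {y} y∈ in z , U⊆V {z} z∈U , yRz)

    β-∩ : ∀ U V → β (U G.∧ V) G.≈ β U G.∧ β V
    β-∩ U V =
        (λ {y} y∈ → proj₂ (∩-≐ F (β U) (β V)) {y}
            ( β-mono {U G.∧ V} {U} (λ {z} z∈ → proj₁ (proj₁ (∩-≐ F U V) {z} z∈)) {y} y∈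
            , β-mono {U G.∧ V} {V} (λ {z} z∈ → proj₂ (proj₁ (∩-≐ F U V) {z} z∈)) {y} y∈))
      , (λ {y} y∈ →
          let y∈βU , y∈βV = proj₁ (∩-≐ F (β U) (β V)) {y} y∈
          in  proj₂ (β-≐ (U G.∧ V)) {y} λ z yRz → proj₂ (∩-≐ F U V) {z}
                (proj₁ (β-≐ U) {y} y∈βU z yRz , proj₁ (β-≐ V) {y} y∈βV z yRz))

    δ-∪ : ∀ U V → δ (U G.∨ V) G.≈ δ U G.∨ δ V
    δ-∪ U V =
        (λ {y} y∈ →
          let z , z∈ , yRz = proj₁ (δ-≐ (U G.∨ V)) {y} y∈
          in  proj₂ (∪-≐ F (δ U) (δ V)) {y} (Sum.map
                (λ z∈U → proj₂ (δ-≐ U) {y} (z , z∈U , yRz))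
                (λ z∈V → proj₂ (δ-≐ V) {y} (z , z∈V , yRz))
                (proj₁ (∪-≐ F U V) {z} z∈)))
      , (λ {y} y∈ → Sum.[
            δ-mono {U} {U G.∨ V} (λ {z} z∈ → proj₂ (∪-≐ F U V) {z} (inj₁ z∈)) {y}
          , δ-mono {V} {U G.∨ V} (λ {z} z∈ → proj₂ (∪-≐ F U V) {z} (inj₂ z∈)) {y}
          ]′ (proj₁ (∪-≐ F (δ U) (δ V)) {y} y∈))

  𝐆𝐅 : GAO (c ⊔ ℓ₂) (c ⊔ ℓ₂) (c ⊔ ℓ₂)
  𝐆𝐅 = record
    { godelAlgebra = 𝐆 F
    ; □      = β
    ; ◇      = δ
    ; □-cong = λ {U} {V} (U⊆V , V⊆U) →
        (λ {y} → β-mono {U} {V} U⊆V {y}) , (λ {y} → β-mono {V} {U} V⊆U {y})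
    ; ◇-cong = λ {U} {V} (U⊆V , V⊆U) →
        (λ {y} → δ-mono {U} {V} U⊆V {y}) , (λ {y} → δ-mono {V} {U} V⊆U {y})
    ; □-⊤    = (λ _ → tt) , λ {y} _ → proj₂ (β-≐ G.⊤) {y} (λ _ _ → tt)
    ; □-∧    = β-∩
    ; ◇-⊥    = (λ {y} y∈ → proj₁ (proj₂ (proj₁ (δ-≐ G.⊥) {y} y∈))) , λ ()
    ; ◇-∨    = δ-∪
    }

-- Every lattice-theoretic existence statement involved is an instance of one
-- principle: in a finite semilattice a decidable up-set P contains a minimal
-- element below any given one.  For P a filter this is its generator, dually
-- for an ideal; for P = {x | x ≰ q} it generates, by distributivity, a prime
-- filter, which gives the separation of p ≰ q by prime filters.
-- A downset U of 𝐅 is r a for the generator a of the ideal {x | r x ⊆ U}.  At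
-- a prime filter f the nontrivial inclusions for □ and ◇ separate a from the
-- generator of the filter □⁻¹(f) and of the ideal {x | ◇ x ∉ f}.
{-# OPTIONS --safe #-}
module Submission where

open import Data.List.Base using (List; []; _∷_; tabulate)
open import Data.List.Relation.Unary.All as All using (All; []; _∷_)
open import Data.List.Relation.Unary.All.Properties using (tabulate⁻)
open import Data.Product.Base using (_×_; ∃; _,_; proj₁; proj₂)
open import Data.Sum.Base as Sum using (_⊎_; inj₁; inj₂)
open import Data.Unit.Base using (tt)
open import Function.Base using (_∘_)
open import Function.Definitions using (Injective; Surjective)
open import Level using (Level)
open import Relation.Binary.Bundles using (Poset)
import Relation.Binary.Definitions as Binary
open import Relation.Binary.Lattice using (BoundedMeetSemilattice)
import Relation.Binary.Lattice.Properties.BoundedJoinSemilattice as BoundedJoin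
import Relation.Binary.Lattice.Properties.HeytingAlgebra as Heyting
import Relation.Binary.Lattice.Properties.JoinSemilattice as Join
open import Relation.Nullary using (¬_; Dec; yes; no; contradiction)
open import Relation.Nullary.Decidable
  using (decidable-stable; isYes; map′; ¬?; _→-dec_)
open import Relation.Unary using (Pred; Decidable; _≐_; _∈_; _∉_)
open import Defs

private
  variable
    c ℓ₁ ℓ₂ p : Level

-- Minimal elements of decidable up-sets in a finite meet-semilattice.

module FiniteMeet (M : BoundedMeetSemilattice c ℓ₁ ℓ₂)
  (M-finite : Finite (Poset.Eq.setoid (BoundedMeetSemilattice.poset M))) where

  open BoundedMeetSemilattice M
  open Finite M-finite using (to; from; strictlyInverseʳ)

  module _ {P : Pred Carrier p} (P? : Decidable P)
           (upward : ∀ {x y} → x ≤ y → P x → P y) where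

    private
      -- For `x` in `P`, holding at every `y` amounts to minimality of `x` in `P`. Testing a meet
      -- lets the elements `y` be treated one at a time, deciding only `P`.
      Minimal : Carrier → Carrier → Set _
      Minimal x y = P (x ∧ y) → x ≤ y

      -- Minimality with respect to y persists when x decreases.
      minimalWrt : ∀ {x₀} → P x₀ → (ys : List Carrier) →
                   ∃ λ x → x ≤ x₀ × P x × All (Minimal x) ys
      minimalWrt {x₀} Px₀ [] = x₀ , refl , Px₀ , []
      minimalWrt {x₀} Px₀ (y ∷ ys) with minimalWrt Px₀ ys
      ... | x , x≤x₀ , Px , min with P? (x ∧ y)
      ...   | no ¬P[x∧y] = x , x≤x₀ , Px , (λ P[x∧y] → contradiction P[x∧y] ¬P[x∧y]) ∷ min
      -- The smaller candidate `x ∧ y` meets its condition at `y` outright, being below `y`.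
      ...   | yes P[x∧y] =
              x ∧ y , trans (x∧y≤x x y) x≤x₀ , P[x∧y] , (λ _ → x∧y≤y x y) ∷
              All.map (λ {z} h P[x∧y∧z] → trans (x∧y≤x x y) (h (upward
                (∧-greatest (trans (x∧y≤x _ z) (x∧y≤x x y)) (x∧y≤y _ z)) P[x∧y∧z]))) min

    minimal : ∀ {x₀} → P x₀ →
              ∃ λ x → x ≤ x₀ × P x × (∀ {y} → P (x ∧ y) → x ≤ y)
    minimal Px₀ with minimalWrt Px₀ (tabulate from)
    ... | x , x≤x₀ , Px , min = x , x≤x₀ , Px , λ {y} P[x∧y] →
      let y≈ = strictlyInverseʳ y in
      trans
        (tabulate⁻ min (to y) (upward
          (∧-greatest (x∧y≤x x y) (trans (x∧y≤y x y) (reflexive (Eq.sym y≈)))) P[x∧y]))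
        (reflexive y≈)

    -- A minimal element of a filter is its least one, since its meet with any other member stays in
    -- the filter.
    filter-generator : P ⊤ → (∀ {x y} → P x → P y → P (x ∧ y)) →
                       ∃ λ x → P x × (∀ {y} → P y → x ≤ y)
    filter-generator P⊤ ∧-closed with minimal P⊤
    ... | x , _ , Px , min = x , Px , λ Py → min (∧-closed Px Py)

-- Separation by prime filters and the isomorphism of Gödel algebras.

module _ (A : GodelAlgebra c ℓ₁ ℓ₂) (A-finite : Finite (GodelAlgebra.setoid A)) where
  open GodelAlgebra A
  open Finite A-finite using (_≟_)
  open Heyting heytingAlgebra using (⇨-eval; ∧-distribˡ-∨-≤)

  private
    F = 𝐅 A A-finite
    module F = Forest F
    module G = GodelAlgebra (𝐆 F)

    _≤?_ : Binary.Decidable _≤_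
    _≤?_ = Join.≈-dec⇒≤-dec joinSemilattice _≟_

    r′ : Carrier → Downset F
    r′ = r A A-finite

  module Filters = FiniteMeet boundedMeetSemilattice A-finite
  -- In the dual order joins are meets, so `filter-generator` yields the greatest element of a
  -- decidable ideal.
  module Ideals  = FiniteMeet
    (BoundedJoin.dualBoundedMeetSemilattice boundedJoinSemilattice) A-finite

  prime-separation : ∀ {p q} → ¬ p ≤ q → ∃ λ (f : PrimeFilter A) → p ∈ El f × q ∉ El f
  prime-separation {p} {q} p≰q
    with Filters.minimal (λ x → ¬? (x ≤? q)) (λ x≤y x≰q y≤q → x≰q (trans x≤y y≤q)) p≰q
  ... | m , m≤p , m≰q , min = f , ∈⁺ m≤p , m≰q ∘ ∈⁻
    where
    ∈⁺ = λ {x} → proj₂ (isYes-≐ (m ≤?_)) {x}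
    ∈⁻ = λ {x} → proj₁ (isYes-≐ (m ≤?_)) {x}

    prime : ∀ {x y} → m ≤ x ∨ y → m ≤ x ⊎ m ≤ y
    prime {x} {y} m≤x∨y with m ≤? x
    ... | yes m≤x = inj₁ m≤x
    -- Minimality puts `m ∧ x` below `q`. Were `m ∧ y` below `q` too, distributivity would give
    -- `m ≤ q`; so `m ∧ y ≰ q`, and minimality gives `m ≤ y`.
    ... | no  m≰x = inj₂ (min λ m∧y≤q → m≰q
      (trans (∧-greatest refl m≤x∨y) (trans (∧-distribˡ-∨-≤ m x y) (∨-least
        (decidable-stable ((m ∧ x) ≤? q) λ m∧x≰q → m≰x (min m∧x≰q)) m∧y≤q))))

    f : PrimeFilter A
    f = record
      { member        = isYes ∘ (m ≤?_)
      ; isPrimeFilter = record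
        { ⊤∈       = ∈⁺ (maximum m)
        ; ∧-closed = λ x∈ y∈ → ∈⁺ (∧-greatest (∈⁻ x∈) (∈⁻ y∈))
        ; upward   = λ x≤y x∈ → ∈⁺ (trans (∈⁻ x∈) x≤y)
        ; proper   = λ ⊥∈ → m≰q (trans (∈⁻ ⊥∈) (minimum q))
        ; prime    = λ x∨y∈ → Sum.map ∈⁺ ∈⁺ (prime (∈⁻ x∨y∈))
        }
      }

  -- Reduces inclusion of `f` in another filter to membership of the single element `m`.
  primeFilter-generator : (f : PrimeFilter A) → ∃ λ m → m ∈ El f × (∀ {x} → x ∈ El f → m ≤ x)
  primeFilter-generator f = Filters.filter-generator (El? f) upward ⊤∈ ∧-closed
    where open PrimeFilter f

  r-≐ : ∀ x → ⟦ r′ x ⟧ ≐ λ f → x ∈ El f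
  r-≐ x = isYes-≐ (λ f → El? f x)

  private
    r⁺ : ∀ {x} f → x ∈ El f → f ∈ ⟦ r′ x ⟧
    r⁺ {x} f = proj₂ (r-≐ x) {f}

    r⁻ : ∀ {x} f → f ∈ ⟦ r′ x ⟧ → x ∈ El f
    r⁻ {x} f = proj₁ (r-≐ x) {f}

  r-mono : ∀ {x y} → x ≤ y → r′ x G.≤ r′ y
  r-mono x≤y {f} f∈ = r⁺ f (PrimeFilter.upward f x≤y (r⁻ f f∈))

  r-cancel-≤ : ∀ {x y} → r′ x G.≤ r′ y → x ≤ y
  r-cancel-≤ {x} {y} rx≤ry = decidable-stable (x ≤? y) λ x≰y →
    let f , x∈f , y∉f = prime-separation x≰y
    in y∉f (r⁻ f (rx≤ry {f} (r⁺ f x∈f)))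

  r-∧ : ∀ x y → r′ (x ∧ y) G.≈ r′ x G.∧ r′ y
  r-∧ x y =
      (λ {f} f∈ → proj₂ (∩-≐ F (r′ x) (r′ y)) {f}
        (r-mono (x∧y≤x x y) {f} f∈ , r-mono (x∧y≤y x y) {f} f∈))
    , (λ {f} f∈ → let f∈x , f∈y = proj₁ (∩-≐ F (r′ x) (r′ y)) {f} f∈
        in r⁺ f (PrimeFilter.∧-closed f (r⁻ f f∈x) (r⁻ f f∈y)))

  r-∨ : ∀ x y → r′ (x ∨ y) G.≈ r′ x G.∨ r′ y
  r-∨ x y =
      (λ {f} f∈ → proj₂ (∪-≐ F (r′ x) (r′ y)) {f}
        (Sum.map (r⁺ f) (r⁺ f) (PrimeFilter.prime f (r⁻ f f∈))))
    , (λ {f} f∈ → Sum.[ r-mono (x≤x∨y x y) {f} , r-mono (y≤x∨y x y) {f} ]′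
        (proj₁ (∪-≐ F (r′ x) (r′ y)) {f} f∈))

  r-⇨ : ∀ x y → r′ (x ⇨ y) G.≈ r′ x G.⇨ r′ y
  r-⇨ x y =
      (λ {f} f∈ → proj₂ (⇨-≐ F (r′ x) (r′ y)) {f}
        λ { (g , f⊆g , g∈x , g∉y) → g∉y (r⁺ g (PrimeFilter.upward g ⇨-eval
              (PrimeFilter.∧-closed g (f⊆g (r⁻ f f∈)) (r⁻ g g∈x)))) })
    , (λ {f} f∈ → r⁺ f (decidable-stable (El? f (x ⇨ y)) λ x⇨y∉f →
        proj₁ (⇨-≐ F (r′ x) (r′ y)) {f} f∈ (above f x⇨y∉f)))
    where
    above : ∀ f → x ⇨ y ∉ El f → Up∖ F (r′ x) (r′ y) f
    above f x⇨y∉f =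
      -- A prime filter containing `m ∧ x` but not `y` includes `f`, hence lies below `f` in the
      -- forest. It exists because `m ∧ x ≤ y` would put `x ⇨ y` in `f` by residuation.
      let m , m∈f , m≤ = primeFilter-generator f
          g , m∧x∈g , y∉g = prime-separation {m ∧ x} {y} λ m∧x≤y →
            x⇨y∉f (PrimeFilter.upward f (transpose-⇨ m∧x≤y) m∈f)
      in g
       , (λ z∈f → PrimeFilter.upward g (trans (x∧y≤x m x) (m≤ z∈f)) m∧x∈g)
       , r⁺ g (PrimeFilter.upward g (x∧y≤y m x) m∧x∈g)
       , y∉g ∘ r⁻ g

  r-⊥ : r′ ⊥ G.≈ G.⊥
  r-⊥ = (λ {f} f∈ → contradiction (r⁻ f f∈) (PrimeFilter.proper f)) , λ ()

  r-⊤ : r′ ⊤ G.≈ G.⊤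
  r-⊤ = (λ _ → tt) , λ {f} _ → r⁺ f (PrimeFilter.⊤∈ f)

  r-injective : Injective _≈_ G._≈_ r′
  r-injective {x} {y} (rx≤ry , ry≤rx) =
    antisym (r-cancel-≤ (λ {f} → rx≤ry {f})) (r-cancel-≤ (λ {f} → ry≤rx {f}))

  private
    r≤? : ∀ U x → Dec (r′ x G.≤ U)
    r≤? U x = map′ (λ h {f} → h f) (λ h f → h {f}) (Finite.all? F.finite
      (λ {f} {g} f≈g h g∈ → ⟦⟧-resp U {f} {g} f≈g
        (h (⟦⟧-resp (r′ x) {g} {f} (F.Eq.sym {f} {g} f≈g) g∈)))
      (λ f → (f ∈? r′ x) →-dec (f ∈? U)))

  r-image : ∀ U → ∃ λ x → r′ x G.≈ U
  r-image U with Ideals.filter-generator (r≤? U)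
    (λ y≤x rx≤U {f} f∈ → rx≤U {f} (r-mono y≤x {f} f∈))
    (λ {f} f∈ → contradiction (r⁻ f f∈) (PrimeFilter.proper f))
    (λ {x} {y} rx≤U ry≤U {f} f∈ → Sum.[ rx≤U {f} , ry≤U {f} ]′
      (proj₁ (∪-≐ F (r′ x) (r′ y)) {f} (proj₁ (r-∨ x y) {f} f∈)))
  ... | a , ra≤U , max = a , (λ {f} → ra≤U {f}) , λ {f} f∈U →
    -- Any prime filter containing `m` includes `f`, so it lies in the downset `U`. Thus `m` belongs
    -- to the ideal, whence `m ≤ a` and `a` is in `f`.
    let m , m∈f , m≤ = primeFilter-generator f
    in r⁺ f (PrimeFilter.upward f
         (max λ {g} g∈m → Downset.closed U {f} {g}
           (λ x∈f → PrimeFilter.upward g (m≤ x∈f) (r⁻ g g∈m)) f∈U)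
         m∈f)

  r-cong : ∀ {x y} → x ≈ y → r′ x G.≈ r′ y
  r-cong x≈y = (λ {f} → r-mono (reflexive x≈y) {f})
             , (λ {f} → r-mono (reflexive (Eq.sym x≈y)) {f})

  r-surjective : Surjective _≈_ G._≈_ r′
  r-surjective U =
    let a , ra≈U = r-image U
    in a , λ {x} x≈a → G.Eq.trans {r′ x} {r′ a} {U} (r-cong x≈a) ra≈U

-- Compatibility of `r` with the operators.

module _ (A : GAO c ℓ₁ ℓ₂) (A-finite : Finite (GAO.setoid A)) where
  open GAO A

  private
    F = 𝐅 godelAlgebra A-finite
    module G = GAO (𝐆𝐅 A A-finite)

    r′ : Carrier → Downset F
    r′ = r godelAlgebra A-finite

    r⁺ : ∀ {x} f → x ∈ El f → f ∈ ⟦ r′ x ⟧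
    r⁺ {x} f = proj₂ (r-≐ godelAlgebra A-finite x) {f}

    r⁻ : ∀ {x} f → f ∈ ⟦ r′ x ⟧ → x ∈ El f
    r⁻ {x} f = proj₁ (r-≐ godelAlgebra A-finite x) {f}

  □-mono : ∀ {x y} → x ≤ y → □ x ≤ □ y
  □-mono {x} {y} x≤y = trans
    (reflexive (□-cong (antisym (∧-greatest refl x≤y) (x∧y≤x x y))))
    (trans (reflexive (□-∧ x y)) (x∧y≤y (□ x) (□ y)))

  ◇-mono : ∀ {x y} → x ≤ y → ◇ x ≤ ◇ y
  ◇-mono {x} {y} x≤y = trans (x≤x∨y (◇ x) (◇ y)) (trans
    (reflexive (Eq.sym (◇-∨ x y)))
    (reflexive (◇-cong (antisym (∨-least x≤y refl) (y≤x∨y x y)))))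

  -- The preimage of `f` under `□` is a filter with generator `m`, and `m ≤ a` would force `□ a`
  -- into `f`. Any filter containing `m` is an `R□`-successor of `f`.
  □-prime-separation : ∀ f {a} → □ a ∉ El f →
                       ∃ λ g → R□ A A-finite f g × a ∉ El g
  □-prime-separation f {a} □a∉f =
    let open PrimeFilter f
        m , □m∈f , m≤ = Filters.filter-generator godelAlgebra A-finite
          (λ x → El? f (□ x)) (upward ∘ □-mono)
          (upward (reflexive (Eq.sym □-⊤)) ⊤∈)
          (λ □x∈ □y∈ → upward (reflexive (Eq.sym (□-∧ _ _))) (∧-closed □x∈ □y∈))
        g , m∈g , a∉g = prime-separation godelAlgebra A-finite
          (λ m≤a → □a∉f (upward (□-mono m≤a) □m∈f))
    in g , (λ □x∈f → PrimeFilter.upward g (m≤ □x∈f) m∈g) , a∉g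

  -- Since `f` is proper and prime, the `x` with `◇ x` outside `f` form an ideal. A filter avoiding
  -- its greatest element `q` avoids all of it, which is exactly `R◇`.
  ◇-prime-separation : ∀ f {a} → ◇ a ∈ El f →
                       ∃ λ g → a ∈ El g × R◇ A A-finite f g
  ◇-prime-separation f {a} ◇a∈f =
    let open PrimeFilter f
        q , ◇q∉f , ≤q = Ideals.filter-generator godelAlgebra A-finite
          (λ x → ¬? (El? f (◇ x)))
          (λ y≤x ◇x∉ ◇y∈ → ◇x∉ (upward (◇-mono y≤x) ◇y∈))
          (proper ∘ upward (reflexive ◇-⊥))
          (λ ◇x∉ ◇y∉ ◇x∨y∈ →
            Sum.[ ◇x∉ , ◇y∉ ]′ (prime (upward (reflexive (◇-∨ _ _)) ◇x∨y∈)))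
        g , a∈g , q∉g = prime-separation godelAlgebra A-finite
          (λ a≤q → ◇q∉f (upward (◇-mono a≤q) ◇a∈f))
    in g , a∈g , λ {x} x∈g → decidable-stable (El? f (◇ x)) λ ◇x∉f →
         q∉g (PrimeFilter.upward g (≤q ◇x∉f) x∈g)

  r-□ : ∀ a → r′ (□ a) G.≈ β A A-finite (r′ a)
  r-□ a =
      (λ {f} f∈ → proj₂ (β-≐ A A-finite (r′ a)) {f} λ g fRg → r⁺ g (fRg (r⁻ f f∈)))
    , (λ {f} f∈ → r⁺ f (decidable-stable (El? f (□ a)) λ □a∉f →
        let g , fRg , a∉g = □-prime-separation f □a∉f
        in a∉g (r⁻ g (proj₁ (β-≐ A A-finite (r′ a)) {f} f∈ g fRg))))

  r-◇ : ∀ a → r′ (◇ a) G.≈ δ A A-finite (r′ a)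
  r-◇ a =
      (λ {f} f∈ → proj₂ (δ-≐ A A-finite (r′ a)) {f}
        (let g , a∈g , fRg = ◇-prime-separation f (r⁻ f f∈) in g , r⁺ g a∈g , fRg))
    , (λ {f} f∈ → let g , g∈ , fRg = proj₁ (δ-≐ A A-finite (r′ a)) {f} f∈
        in r⁺ f (fRg (r⁻ g g∈)))

  r-isGAOIsomorphism : IsGAOIsomorphism A (𝐆𝐅 A A-finite) r′
  r-isGAOIsomorphism = record
    { cong      = r-cong godelAlgebra A-finite
    ; ∧-homo    = r-∧ godelAlgebra A-finite
    ; ∨-homo    = r-∨ godelAlgebra A-finite
    ; ⇨-homo    = r-⇨ godelAlgebra A-finite
    ; ⊥-homo    = r-⊥ godelAlgebra A-finite
    ; ⊤-homo    = r-⊤ godelAlgebra A-finite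
    ; □-homo    = r-□
    ; ◇-homo    = r-◇
    ; bijective = r-injective godelAlgebra A-finite , r-surjective godelAlgebra A-finite
    }

theorem3p6 : ∀ {c ℓ₁ ℓ₂ : Level} (A : GAO c ℓ₁ ℓ₂) (A-finite : Finite (GAO.setoid A)) →
    IsGAOIsomorphism A (𝐆𝐅 A A-finite) (r (GAO.godelAlgebra A) A-finite)
    × (∀ (a : GAO.Carrier A) →
    ⟦ r (GAO.godelAlgebra A) A-finite (GAO.□ A a) ⟧
    ≐ ⟦ β A A-finite (r (GAO.godelAlgebra A) A-finite a) ⟧)
    × (∀ (a : GAO.Carrier A) →
    ⟦ r (GAO.godelAlgebra A) A-finite (GAO.◇ A a) ⟧
    ≐ ⟦ δ A A-finite (r (GAO.godelAlgebra A) A-finite a) ⟧)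
theorem3p6 A A-finite = r-isGAOIsomorphism A A-finite , r-□ A A-finite , r-◇ A A-finite
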